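{- Let $r\ge 1$ and $g\ge 3$ be integers and let $n[1,r;g]$ denote the order of a $[1,r;g]$-mixed cage. Then $$n[1,r;g]\ \ge\ \begin{cases} 2\left(1+\sum_{i=1}^{(g-3)/2} n_0(r,2i+1)\right)+n_0(r,g) & \text{if } g \text{ is odd},\\[1mm] 2\left(1+\sum_{i=1}^{(g-2)/2} n_0(r,2i+1)\right) & \text{if } g \text{ is even},\end{cases}$$ where $n_0(r,g)=1+r+r(r-1)+\cdots+r(r-1)^{(g-3)/2}$ for odd $g$ and $n_0(r,g)=2\left(1+(r-1)+\cdots+(r-1)^{g/2-1}\right)$ for even $g$.
   Context: A mixed graph is a finite graph that may contain both edges and arcs. A $[z,r;g]$-mixed graph is a mixed graph in which every vertex is the tail of exactly $z$ arcs, the head of exactly $z$ arcs, and is incident with exactly $r$ edges, and whose girth is $g$. Walks traverse edges in either direction and arcs only in their direction; a cycle is a closed walk with no repeated vertices (other than start = end) and no repeated edge or arc; the girth is the length of a shortest cycle. A $[z,r;g]$-mixed cage is a $[z,r;g]$-mixed graph of minimum order. -}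

module Defs where

open import Data.Fin.Base using (Fin)
open import Data.List.Base
  using (List; []; _∷_; length; filter; allFin; applyUpTo)
open import Data.List.Relation.Unary.AllPairs using (AllPairs)
open import Data.List.Relation.Unary.Unique.Propositional using (Unique)
open import Data.Nat.Base
  using (ℕ; suc; _+_; _*_; _∸_; _^_; _/_; _≤_; _<_; parity)
open import Data.Nat.ListAction using (sum)
open import Data.Parity.Base using (Parity; 0ℙ; 1ℙ)
open import Data.Product.Base using (_×_; Σ-syntax; ∃-syntax)
open import Level using (0ℓ)
open import Relation.Binary.Core using (Rel)
open import Relation.Binary.Definitions using (Decidable; Irreflexive; Symmetric)
open import Relation.Binary.PropositionalEquality.Core using (_≡_)
open import Relation.Nullary.Negation.Core using (¬_)
open import Relation.Unary using (Pred)
import Relation.Unary as U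

-- As usual for graphs, there are no loops and no parallel edges or parallel
-- arcs.  Opposite arcs, and an edge and an arc on the same two vertices, are
-- allowed; each of these configurations forms a cycle of length 2.
record MixedGraph : Set₁ where
  field
    order : ℕ

  Vertex : Set
  Vertex = Fin order

  field
    Edge       : Rel Vertex 0ℓ
    Arc        : Rel Vertex 0ℓ
    edge?      : Decidable Edge
    arc?       : Decidable Arc
    edge-sym   : Symmetric Edge
    edge-irrefl : Irreflexive _≡_ Edge
    arc-irrefl  : Irreflexive _≡_ Arc

  count : {P : Pred Vertex 0ℓ} → U.Decidable P → ℕ
  count P? = length (filter P? (allFin order))

  degree outDegree inDegree : Vertex → ℕ
  degree    v = count (λ u → edge? v u)
  outDegree v = count (λ u → arc? v u)
  inDegree  v = count (λ u → arc? u v)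

  data Step (u v : Vertex) : Set where
    along-edge : Edge u v → Step u v
    along-arc  : Arc u v → Step u v

  data Walk : Vertex → Vertex → Set where
    []  : ∀ {u} → Walk u u
    _∷_ : ∀ {u v w} → Step u v → Walk v w → Walk u w

  data Link : Set where
    edge arc : Vertex → Vertex → Link

  -- An edge is the same edge whichever way it is traversed.
  data _≈_ : Rel Link 0ℓ where
    same     : ∀ {l} → l ≈ l
    reversed : ∀ {u v} → edge u v ≈ edge v u

  link : ∀ {u v} → Step u v → Link
  link {u} {v} (along-edge _) = edge u v
  link {u} {v} (along-arc _)  = arc u v

  links : ∀ {u v} → Walk u v → List Link
  links []      = []
  links (s ∷ w) = link s ∷ links w

  -- All vertices of the walk except its last one.
  vertices : ∀ {u v} → Walk u v → List Vertex
  vertices []            = []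
  vertices (_∷_ {u} s w) = u ∷ vertices w

  walkLength : ∀ {u v} → Walk u v → ℕ
  walkLength []      = 0
  walkLength (s ∷ w) = suc (walkLength w)

  IsCycle : ∀ {u} → Walk u u → Set
  IsCycle w =
    0 < walkLength w × Unique (vertices w) × AllPairs (λ k l → ¬ k ≈ l) (links w)

  HasGirth : ℕ → Set
  HasGirth g =
      (∃[ u ] Σ[ w ∈ Walk u u ] IsCycle w × walkLength w ≡ g)
    × (∀ {u} (w : Walk u u) → IsCycle w → g ≤ walkLength w)

record IsMixed (z r g : ℕ) (G : MixedGraph) : Set where
  open MixedGraph G
  field
    out-regular  : ∀ v → outDegree v ≡ z
    in-regular   : ∀ v → inDegree v ≡ z
    edge-regular : ∀ v → degree v ≡ r
    girth        : HasGirth g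

record IsMixedCage (z r g : ℕ) (G : MixedGraph) : Set₁ where
  open MixedGraph using (order)
  field
    isMixed : IsMixed z r g G
    minimal : ∀ H → IsMixed z r g H → order G ≤ order H

-- n[z,r;g] as a relation: its value is n.
CageOrder : (z r g n : ℕ) → Set₁
CageOrder z r g n = ∃[ G ] IsMixedCage z r g G × MixedGraph.order G ≡ n

-- f 0 + ⋯ + f (m ∸ 1)
∑< : ℕ → (ℕ → ℕ) → ℕ
∑< m f = sum (applyUpTo f m)

-- f 1 + ⋯ + f m
∑₁ : ℕ → (ℕ → ℕ) → ℕ
∑₁ m f = ∑< m (λ i → f (suc i))

-- For odd g the exponents 0, …, (g - 3)/2 number (g - 1)/2; for even g the
-- exponents 0, …, g/2 - 1 number g/2.  Note 0 ^ 0 = 1, as needed for r = 1.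
n₀ : ℕ → ℕ → ℕ
n₀ r g with parity g
... | 1ℙ = 1 + ∑< ((g ∸ 1) / 2) (λ k → r * (r ∸ 1) ^ k)
... | 0ℙ = 2 * ∑< (g / 2) (λ k → (r ∸ 1) ^ k)

lowerBound : ℕ → ℕ → ℕ
lowerBound r g with parity g
... | 1ℙ = 2 * (1 + ∑₁ ((g ∸ 3) / 2) (λ i → n₀ r (2 * i + 1))) + n₀ r g
... | 0ℙ = 2 * (1 + ∑₁ ((g ∸ 2) / 2) (λ i → n₀ r (2 * i + 1)))

{-# OPTIONS --safe #-}
-- Follow g consecutive vertices x₀ → x₁ → ⋯ along the arcs, and root at xᵢ the
-- tree of non-backtracking walks along edges, of depth min (i, g - 1 - i).
-- Within one tree, two walks with the same endpoint would close up to a closed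
-- non-backtracking walk of length less than g, which contains a cycle.  If the
-- trees at xᵢ and xⱼ with i < j met, the arcs from xᵢ to xⱼ and the tree walks
-- back to xᵢ would form a closed walk through an arc of length at most
-- (j - i) + i + (g - 1 - j) = g - 1, which also contains a cycle.  So the trees
-- are disjoint, and their sizes add up to the bound.
module Submission where

open import Defs
open import Data.Fin.Base using (Fin)
open import Data.Fin.Properties using (_≟_; injective⇒≤)
open import Data.List.Base
  using (List; []; _∷_; _∷ʳ_; length; filter; allFin; applyUpTo; concat; concatMap; lookup)
open import Data.List.Membership.Propositional using (_∈_; find)
open import Data.List.Membership.Propositional.Properties
  using (∈-++⁺ˡ; ∈-++⁺ʳ; ∈-lookup; ∈-filter⁻; ∈-concatMap⁻)
import Data.List.Membership.DecPropositional as DecMembership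
open import Data.List.Properties using (length-++; filter-all; applyUpTo-∷ʳ)
open import Data.List.Relation.Binary.Disjoint.Propositional using (Disjoint)
open import Data.List.Relation.Binary.Permutation.Propositional using (↭-sym; ↭⇒↭ₛ)
open import Data.List.Relation.Binary.Permutation.Propositional.Properties using (∷↭∷ʳ)
import Data.List.Relation.Binary.Permutation.Setoid.Properties as Permutation
open import Data.List.Relation.Binary.Subset.Propositional using (_⊆_)
open import Data.List.Relation.Unary.All as All using ([]; _∷_)
import Data.List.Relation.Unary.All.Properties as All
open import Data.List.Relation.Unary.AllPairs as AllPairs using (AllPairs; []; _∷_)
import Data.List.Relation.Unary.AllPairs.Properties as AllPairs
open import Data.List.Relation.Unary.Any using (here; there)
open import Data.List.Relation.Unary.Unique.Propositional using (Unique)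
import Data.List.Relation.Unary.Unique.Propositional.Properties as Unique
open import Data.Nat.Base
open import Data.Nat.DivMod using (m*n/n≡m)
open import Data.Nat.ListAction using (sum)
open import Data.Nat.ListAction.Properties using (sum-++)
open import Data.Nat.Properties hiding (_≟_)
open import Data.Nat.Tactic.RingSolver using (solve-∀)
open import Data.Parity.Base using (0ℙ; 1ℙ)
open import Data.Product.Base using (_×_; _,_; Σ-syntax; ∃-syntax; proj₁; proj₂)
open import Data.Sum.Base using (_⊎_; inj₁; inj₂)
open import Function.Base using (_∘_)
open import Relation.Binary.PropositionalEquality
  using (_≡_; _≢_; refl; sym; trans; cong; cong₂; subst; setoid; module ≡-Reasoning)
open import Relation.Nullary.Decidable using (yes; no; ¬?)
open import Relation.Nullary.Negation using (¬_; contradiction)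

-- Lists: distinct entries and lengths.

lookup-injective : ∀ {A : Set} {xs : List A} → Unique xs →
                   ∀ {i j} → lookup xs i ≡ lookup xs j → i ≡ j
lookup-injective (_ ∷ _) {Fin.zero} {Fin.zero} _ = refl
lookup-injective {xs = _ ∷ xs} (x∉ ∷ _) {Fin.zero} {Fin.suc j} eq =
  contradiction eq (All.lookup x∉ (∈-lookup j))
lookup-injective {xs = _ ∷ xs} (x∉ ∷ _) {Fin.suc i} {Fin.zero} eq =
  contradiction (sym eq) (All.lookup x∉ (∈-lookup i))
lookup-injective (_ ∷ u) {Fin.suc i} {Fin.suc j} eq = cong Fin.suc (lookup-injective u eq)

unique⇒length≤ : ∀ {n} {xs : List (Fin n)} → Unique xs → length xs ≤ n
unique⇒length≤ u = injective⇒≤ (lookup-injective u)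

allPairs-tabulate : ∀ {A : Set} {R : A → A → Set} {xs : List A} → Unique xs →
                    (∀ {x y} → x ∈ xs → y ∈ xs → x ≢ y → R x y) → AllPairs R xs
allPairs-tabulate []        f = []
allPairs-tabulate (x∉ ∷ uq) f =
  All.tabulate (λ y∈ → f (here refl) (there y∈) (All.lookup x∉ y∈)) ∷
  allPairs-tabulate uq (λ x∈ y∈ → f (there x∈) (there y∈))

-- Among distinct entries at most one equals `p`; once it is met, the filter removes nothing more.
length≤1+length-filter-≢ : ∀ {n} (p : Fin n) {xs} → Unique xs →
                           length xs ≤ suc (length (filter (λ x → ¬? (x ≟ p)) xs))
length≤1+length-filter-≢ p [] = z≤n
length≤1+length-filter-≢ p {x ∷ xs} (x∉ ∷ uq) with x ≟ p
... | no _     = s≤s (length≤1+length-filter-≢ p uq)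
... | yes refl = s≤s (≤-reflexive (cong length (sym
  (filter-all (λ y → ¬? (y ≟ p)) (All.map (λ p≢y → p≢y ∘ sym) x∉)))))

length-concatMap-≥ : ∀ {A B : Set} {m} (f : A → List B) xs → (∀ x → m ≤ length (f x)) →
                     length xs * m ≤ length (concatMap f xs)
length-concatMap-≥ f []       m≤ = z≤n
length-concatMap-≥ f (x ∷ xs) m≤ = ≤-trans
  (+-mono-≤ (m≤ x) (length-concatMap-≥ f xs m≤))
  (≤-reflexive (sym (length-++ (f x))))

∑<-≤-length-concat : ∀ {A : Set} {f : ℕ → ℕ} (F : ℕ → List A) n → (∀ i → f i ≤ length (F i)) →
                     ∑< n f ≤ length (concat (applyUpTo F n))
∑<-≤-length-concat F zero    f≤ = z≤n
∑<-≤-length-concat F (suc n) f≤ = ≤-trans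
  (+-mono-≤ (f≤ 0) (∑<-≤-length-concat (F ∘ suc) n (f≤ ∘ suc)))
  (≤-reflexive (sym (length-++ (F 0))))

-- Finite sums, and the bound as a sum of ball sizes.

∑<-cong : ∀ n {f h : ℕ → ℕ} → (∀ {i} → i < n → f i ≡ h i) → ∑< n f ≡ ∑< n h
∑<-cong zero    eq = refl
∑<-cong (suc n) eq = cong₂ _+_ (eq z<s) (∑<-cong n (eq ∘ s<s))

∑<-last : ∀ n f → ∑< (suc n) f ≡ ∑< n f + f n
∑<-last n f = begin
  ∑< (suc n) f                          ≡⟨ cong sum (applyUpTo-∷ʳ f n) ⟨
  sum (applyUpTo f n ∷ʳ f n)            ≡⟨ sum-++ (applyUpTo f n) (f n ∷ []) ⟩
  ∑< n f + (f n + 0)                    ≡⟨ cong (∑< n f +_) (+-identityʳ (f n)) ⟩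
  ∑< n f + f n                          ∎
  where open ≡-Reasoning

∑<-*ˡ : ∀ c n f → ∑< n (λ i → c * f i) ≡ c * ∑< n f
∑<-*ˡ c zero    f = sym (*-zeroʳ c)
∑<-*ˡ c (suc n) f = trans (cong (c * f 0 +_) (∑<-*ˡ c n (f ∘ suc)))
                          (sym (*-distribˡ-+ c (f 0) (∑< n (f ∘ suc))))

-- The order of a ball of radius `d` in the `r`-regular tree: the Moore bound for girth 2d + 1.
ballSize : ℕ → ℕ → ℕ
ballSize r d = 1 + ∑< d (λ k → r * (r ∸ 1) ^ k)

depth : ℕ → ℕ → ℕ
depth g i = i ⊓ (g ∸ suc i)

-- Both ends of the path have depth 0, and each of the `g` positions between them is one deeper than
-- on a path of `g` vertices. This drives the inductions in steps of two.
∑-depth-step : ∀ g f → ∑< (2 + g) (f ∘ depth (2 + g)) ≡ f 0 + (∑< g (f ∘ suc ∘ depth g) + f 0)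
∑-depth-step g f = cong (f 0 +_) (begin
  ∑< (suc g) h              ≡⟨ ∑<-last g h ⟩
  ∑< g h + h g              ≡⟨ cong₂ _+_ (∑<-cong g shift) last ⟩
  ∑< g (f ∘ suc ∘ depth g) + f 0 ∎)
  where
  open ≡-Reasoning
  h : ℕ → ℕ
  h i = f (suc i ⊓ (g ∸ i))
  shift : ∀ {i} → i < g → h i ≡ f (suc (depth g i))
  shift {i} i<g = cong (λ k → f (suc i ⊓ k)) (+-∸-assoc 1 i<g)
  last : h g ≡ f 0
  last = cong (λ k → f (suc g ⊓ k)) (n∸n≡0 g)

∑-depth-even : ∀ k f → ∑< (k * 2) (f ∘ depth (k * 2)) ≡ 2 * ∑< k f
∑-depth-even zero    f = refl
∑-depth-even (suc k) f = begin
  _                                      ≡⟨ ∑-depth-step (k * 2) f ⟩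
  f 0 + (_ + f 0)                        ≡⟨ cong (λ s → f 0 + (s + f 0)) (∑-depth-even k (f ∘ suc)) ⟩
  f 0 + (2 * ∑< k (f ∘ suc) + f 0)       ≡⟨ rearrange (f 0) (∑< k (f ∘ suc)) ⟩
  2 * (f 0 + ∑< k (f ∘ suc))             ∎
  where
  open ≡-Reasoning
  rearrange : ∀ a s → a + (2 * s + a) ≡ 2 * (a + s)
  rearrange = solve-∀

∑-depth-odd : ∀ k f → ∑< (suc (k * 2)) (f ∘ depth (suc (k * 2))) ≡ 2 * ∑< k f + f k
∑-depth-odd zero    f = +-identityʳ (f 0)
∑-depth-odd (suc k) f = begin
  _                                              ≡⟨ ∑-depth-step (suc (k * 2)) f ⟩
  f 0 + (_ + f 0)                                ≡⟨ cong (λ s → f 0 + (s + f 0)) (∑-depth-odd k (f ∘ suc)) ⟩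
  f 0 + (2 * ∑< k (f ∘ suc) + f (suc k) + f 0)   ≡⟨ rearrange (f 0) (∑< k (f ∘ suc)) (f (suc k)) ⟩
  2 * (f 0 + ∑< k (f ∘ suc)) + f (suc k)         ∎
  where
  open ≡-Reasoning
  rearrange : ∀ a s b → a + (2 * s + b + a) ≡ 2 * (a + s) + b
  rearrange = solve-∀

parity-even : ∀ k → parity (k * 2) ≡ 0ℙ
parity-even zero    = refl
parity-even (suc k) = parity-even k

parity-odd : ∀ k → parity (suc (k * 2)) ≡ 1ℙ
parity-odd zero    = refl
parity-odd (suc k) = parity-odd k

even-or-odd : ∀ g → (∃[ k ] g ≡ k * 2) ⊎ (∃[ k ] g ≡ suc (k * 2))
even-or-odd zero = inj₁ (0 , refl)
even-or-odd (suc g) with even-or-odd g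
... | inj₁ (k , refl) = inj₂ (k , refl)
... | inj₂ (k , refl) = inj₁ (suc k , refl)

k*2/2≡k : ∀ k → k * 2 / 2 ≡ k
k*2/2≡k k = m*n/n≡m k 2

n₀-odd : ∀ r k → n₀ r (suc (k * 2)) ≡ ballSize r k
n₀-odd r k rewrite parity-odd k | k*2/2≡k k = refl

-- The leading 1 is the ball of radius 0, and the term for `i` is the ball of radius `i`.
∑-n₀ : ∀ r k → 1 + ∑₁ k (λ i → n₀ r (2 * i + 1)) ≡ ∑< (suc k) (ballSize r)
∑-n₀ r k = cong suc (∑<-cong k (λ {i} _ →
  trans (cong (n₀ r) (2m+1 (suc i))) (n₀-odd r (suc i))))
  where
  2m+1 : ∀ m → 2 * m + 1 ≡ suc (m * 2)
  2m+1 = solve-∀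

-- With `g` in the form 2k + 3, the truncated `g ∸ 3` computes to `k * 2`.
lowerBound-odd : ∀ r k → lowerBound r (suc (suc k * 2)) ≡
                 2 * ∑< (suc k) (ballSize r) + ballSize r (suc k)
lowerBound-odd r k = trans unfold (cong (λ s → 2 * s + ballSize r (suc k)) (∑-n₀ r k))
  where
  unfold : lowerBound r (suc (suc k * 2)) ≡
           2 * (1 + ∑₁ k (λ i → n₀ r (2 * i + 1))) + ballSize r (suc k)
  unfold rewrite parity-odd k | k*2/2≡k k | n₀-odd r (suc k) = refl

lowerBound-even : ∀ r k → lowerBound r (suc (suc k) * 2) ≡ 2 * ∑< (suc (suc k)) (ballSize r)
lowerBound-even r k = trans unfold (cong (2 *_) (∑-n₀ r (suc k)))
  where
  unfold : lowerBound r (suc (suc k) * 2) ≡ 2 * (1 + ∑₁ (suc k) (λ i → n₀ r (2 * i + 1)))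
  unfold rewrite parity-even k | k*2/2≡k (suc k) = refl

-- Along `g` positions every depth occurs twice, except that for odd `g` the largest occurs only in
-- the middle; that one gives the separate summand `n₀ r g`.
lowerBound-∑ : ∀ r g → 3 ≤ g → lowerBound r g ≡ ∑< g (ballSize r ∘ depth g)
lowerBound-∑ r g 3≤g with even-or-odd g
lowerBound-∑ r _ (s≤s (s≤s ())) | inj₁ (1 , refl)
lowerBound-∑ r _ _ | inj₁ (suc (suc k) , refl) =
  trans (lowerBound-even r k) (sym (∑-depth-even (suc (suc k)) (ballSize r)))
lowerBound-∑ r _ (s≤s ()) | inj₂ (zero , refl)
lowerBound-∑ r _ _ | inj₂ (suc k , refl) =
  trans (lowerBound-odd r k) (sym (∑-depth-odd (suc k) (ballSize r)))

-- Walks, paths and cycles.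

module Walks (G : MixedGraph) where
  open MixedGraph G

  source target : Link → Vertex
  source (edge u _) = u
  source (arc u _)  = u
  target (edge _ v) = v
  target (arc _ v)  = v

  -- `Unique (trace w)` expresses that `w` is a path; `vertices` omits the last vertex, as suits
  -- closed walks.
  trace : ∀ {u v} → Walk u v → List Vertex
  trace {v = v} w = vertices w ∷ʳ v

  trace-head : ∀ {u v} (w : Walk u v) → u ∈ trace w
  trace-head []      = here refl
  trace-head (_ ∷ _) = here refl

  trace-last : ∀ {u v} (w : Walk u v) → v ∈ trace w
  trace-last w = ∈-++⁺ʳ (vertices w) (here refl)

  -- Moving the last vertex to the front is a permutation. The result is the vertex list of the path
  -- closed up by a step from `v` to its start.
  trace-rotate : ∀ {u v} (w : Walk u v) → Unique (trace w) → Unique (v ∷ vertices w)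
  trace-rotate w = Permutation.Unique-resp-↭ (setoid Vertex) (↭⇒↭ₛ (↭-sym (∷↭∷ʳ _ (vertices w))))

  source-∈ : ∀ {u v} (w : Walk u v) {l} → l ∈ links w → source l ∈ vertices w
  source-∈ (along-edge _ ∷ w) (here refl) = here refl
  source-∈ (along-arc _ ∷ w)  (here refl) = here refl
  source-∈ (_ ∷ w)            (there l∈)  = there (source-∈ w l∈)

  target-∈ : ∀ {u v} (w : Walk u v) {l} → l ∈ links w → target l ∈ trace w
  target-∈ (along-edge _ ∷ w) (here refl) = there (trace-head w)
  target-∈ (along-arc _ ∷ w)  (here refl) = there (trace-head w)
  target-∈ (_ ∷ w)            (there l∈)  = there (target-∈ w l∈)

  ≈-endpoint : ∀ {u v} (s : Step u v) {l} → link s ≈ l → u ≡ source l ⊎ u ≡ target l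
  ≈-endpoint (along-edge _) same     = inj₁ refl
  ≈-endpoint (along-edge _) reversed = inj₂ refl
  ≈-endpoint (along-arc _)  same     = inj₁ refl

  -- If the first link recurred, in either direction, the start of the path would be an endpoint of
  -- a later link and so be visited again.
  path-links-distinct : ∀ {u v} (w : Walk u v) → Unique (trace w) →
                        AllPairs (λ k l → ¬ k ≈ l) (links w)
  path-links-distinct []      _         = []
  path-links-distinct (s ∷ w) (u∉ ∷ uq) = All.tabulate distinct ∷ path-links-distinct w uq
    where
    distinct : ∀ {l} → l ∈ links w → ¬ link s ≈ l
    distinct l∈ s≈l with ≈-endpoint s s≈l
    ... | inj₁ refl = contradiction refl (All.lookup u∉ (∈-++⁺ˡ (source-∈ w l∈)))
    ... | inj₂ refl = contradiction refl (All.lookup u∉ (target-∈ w l∈))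

  -- The path itself repeats nothing, so only the closing link can spoil the cycle, as when an edge
  -- is traversed forth and back.
  closing-cycle : ∀ {u v} (s : Step u v) (w : Walk v u) → Unique (trace w) →
                  (∀ {l} → l ∈ links w → ¬ link s ≈ l) → IsCycle (s ∷ w)
  closing-cycle s w uq new =
    s≤s z≤n , trace-rotate w uq , All.tabulate new ∷ path-links-distinct w uq

  suffix : ∀ {u v z} (w : Walk u v) → z ∈ trace w → Unique (trace w) →
           Σ[ w′ ∈ Walk z v ] Unique (trace w′) × walkLength w′ ≤ walkLength w
  suffix []      (here refl) uq       = [] , uq , z≤n
  suffix (s ∷ w) (here refl) uq       = s ∷ w , uq , ≤-refl
  suffix (s ∷ w) (there z∈)  (_ ∷ uq) with suffix w z∈ uq
  ... | w′ , uq′ , le = w′ , uq′ , m≤n⇒m≤1+n le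

  open DecMembership (_≟_ {order}) using (_∈?_)

  -- Loop erasure: if the start lies on the already shortened rest, everything before that visit is
  -- dropped.
  shorten : ∀ {u v} (w : Walk u v) →
            Σ[ w′ ∈ Walk u v ] Unique (trace w′) × walkLength w′ ≤ walkLength w
  shorten []      = [] , [] ∷ [] , z≤n
  shorten {u} (s ∷ w) with shorten w
  ... | w′ , uq , le with u ∈? trace w′
  ...   | no u∉  = s ∷ w′ , All.¬Any⇒All¬ _ u∉ ∷ uq , s≤s le
  ...   | yes u∈ with suffix w′ u∈ uq
  ...     | w″ , uq′ , le′ = w″ , uq′ , m≤n⇒m≤1+n (≤-trans le′ le)

  -- Trails.

  -- A non-backtracking walk along edges whose first step does not go to p.
  -- As there are no loops, Trail v v puts no restriction on the first step.
  data Trail : (p u v : Vertex) → ℕ → Set where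
    []    : ∀ {p u} → Trail p u u 0
    _⟨_⟩∷_ : ∀ {p u v w n} → Edge u v → v ≢ p → Trail u v w n → Trail p u w (suc n)

  walk : ∀ {p u v n} → Trail p u v n → Walk u v
  walk []           = []
  walk (e ⟨ _ ⟩∷ t) = along-edge e ∷ walk t

  walkLength-walk : ∀ {p u v n} (t : Trail p u v n) → walkLength (walk t) ≡ n
  walkLength-walk []           = refl
  walkLength-walk (_ ⟨ _ ⟩∷ t) = cong suc (walkLength-walk t)

  -- The prefix keeps the same `p`, so that it can still follow the edge that precedes `t` without
  -- backtracking. The field `⊆trace` carries the induction for `unique`.
  record Prefix {p u v n} (t : Trail p u v n) (z : Vertex) : Set where
    constructor mkPrefix
    field
      {len}  : ℕ
      trail  : Trail p u z len
      len≤   : len ≤ n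
      ⊆trace : trace (walk trail) ⊆ trace (walk t)
      unique : Unique (trace (walk t)) → Unique (trace (walk trail))

  prefix : ∀ {p u v n z} (t : Trail p u v n) → z ∈ trace (walk t) → Prefix t z
  prefix [] (here refl) = mkPrefix [] z≤n (λ x∈ → x∈) (λ uq → uq)
  prefix (e ⟨ ne ⟩∷ t) (here refl) =
    mkPrefix [] z≤n (λ { (here refl) → here refl }) (λ _ → [] ∷ [])
  prefix {p} {u} {z = z} (e ⟨ ne ⟩∷ t) (there z∈) = mkPrefix (e ⟨ ne ⟩∷ trail) (s≤s len≤) sub uni
    where
    open Prefix (prefix t z∈)
    sub : u ∷ trace (walk trail) ⊆ u ∷ trace (walk t)
    sub (here eq)  = here eq
    sub (there x∈) = there (⊆trace x∈)
    uni : Unique (u ∷ trace (walk t)) → Unique (u ∷ trace (walk trail))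
    uni (u∉ ∷ uq) = All.anti-mono ⊆trace u∉ ∷ unique uq

  -- If `e` recurred in its own direction, the path would visit its end `u` early. Reversed, it
  -- cannot be the first step of `t`, which does not return to `u`, nor a later one, which would
  -- revisit `v`.
  trail-cycle : ∀ {u v n} (e : Edge u v) (t : Trail u v u n) → Unique (trace (walk t)) →
                IsCycle (along-edge e ∷ walk t)
  trail-cycle {u} {v} e t uq = closing-cycle (along-edge e) (walk t) uq (new t uq)
    where
    new : ∀ {n} (t : Trail u v u n) → Unique (trace (walk t)) →
          ∀ {l} → l ∈ links (walk t) → ¬ edge u v ≈ l
    new t uq l∈ same =
      contradiction (source-∈ (walk t) l∈) (Unique.Unique[x∷xs]⇒x∉xs (trace-rotate (walk t) uq))
    new (e ⟨ ne ⟩∷ t) uq (here refl) reversed = contradiction refl ne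
    new (e ⟨ ne ⟩∷ t) (v∉ ∷ _) (there l∈) reversed =
      contradiction refl (All.lookup v∉ (∈-++⁺ˡ (source-∈ (walk t) l∈)))

  WalkOfLength : Vertex → Vertex → ℕ → Set
  WalkOfLength u v n = Σ[ w ∈ Walk u v ] walkLength w ≡ n

  prepend : ∀ {p u v z n m} → Trail p u v n →
            WalkOfLength v z m → WalkOfLength u z (n + m)
  prepend []           w = w
  prepend (e ⟨ _ ⟩∷ t) w with prepend t w
  ... | w′ , eq = along-edge e ∷ w′ , cong suc eq

  reverseOnto : ∀ {p u v z n m} → Trail p u v n →
                WalkOfLength u z m → WalkOfLength v z (n + m)
  reverseOnto [] w = w
  reverseOnto {v = v} {z = z} {m = m} (_⟨_⟩∷_ {n = n} e _ t) (w , eq) =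
    subst (WalkOfLength v z) (+-suc n m)
      (reverseOnto t (along-edge (edge-sym e) ∷ w , cong suc eq))

  -- Two trails leaving the opposite ends of an edge are joined across it. The recursion slides the
  -- edge along the first trail, moving each edge passed to the front of the second.
  reverseTrail : ∀ {u v y z n m} → Edge u v → Trail v u y n → Trail u v z m →
                 Trail y y z (n + suc m)
  reverseTrail e [] t = e ⟨ (λ v≡u → edge-irrefl (sym v≡u) e) ⟩∷ t
  reverseTrail {m = m} e (_⟨_⟩∷_ {n = n} e′ ne t′) t =
    subst (Trail _ _ _) (+-suc n (suc m))
      (reverseTrail (edge-sym e′) t′ (e ⟨ ne ∘ sym ⟩∷ t))

  -- Consequences of the girth.

  module LongCycles (g : ℕ) (girth : ∀ {u} (w : Walk u u) → IsCycle w → g ≤ walkLength w) where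

    -- An arc is `≈` only to itself, and a path ending at `u` has no link that starts at `u`; hence
    -- the arc closes the shortened walk to a cycle.
    closed-walk-through-arc : ∀ {u v} → Arc u v → (w : Walk v u) → g ≤ suc (walkLength w)
    closed-walk-through-arc {u} {v} a w with shorten w
    ... | w′ , uq , le = ≤-trans (girth (along-arc a ∷ w′) (closing-cycle (along-arc a) w′ uq new)) (s≤s le)
      where
      new : ∀ {l} → l ∈ links w′ → ¬ arc u v ≈ l
      new l∈ same =
        contradiction (source-∈ w′ l∈) (Unique.Unique[x∷xs]⇒x∉xs (trace-rotate w′ uq))

    -- When the rest is a path that meets `u` again, its prefix up to that visit closes with `e` to
    -- a cycle no longer than the trail.
    path-or-long : ∀ {p u v n} (t : Trail p u v n) → Unique (trace (walk t)) ⊎ g ≤ n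
    path-or-long [] = inj₁ ([] ∷ [])
    path-or-long {u = u} (e ⟨ ne ⟩∷ t) with path-or-long t
    ... | inj₂ le = inj₂ (m≤n⇒m≤1+n le)
    ... | inj₁ uq with u ∈? trace (walk t)
    ...   | no u∉  = inj₁ (All.¬Any⇒All¬ _ u∉ ∷ uq)
    ...   | yes u∈ = inj₂ (begin
      g                               ≤⟨ girth (along-edge e ∷ walk trail) (trail-cycle e trail (unique uq)) ⟩
      suc (walkLength (walk trail))   ≡⟨ cong suc (walkLength-walk trail) ⟩
      suc len                         ≤⟨ s≤s len≤ ⟩
      suc _                           ∎)
      where
      open ≤-Reasoning
      open Prefix (prefix t u∈)

    closed-trail : ∀ {p u n} → 0 < n → Trail p u u n → g ≤ n
    closed-trail _ t@(_ ⟨ _ ⟩∷ t′) with path-or-long t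
    ... | inj₁ (u∉ ∷ _) = contradiction refl (All.lookup u∉ (trace-last (walk t′)))
    ... | inj₂ le       = le

    -- Trees of trails and their distinct entries.

    neighbours : (p v : Vertex) → List Vertex
    neighbours p v = filter (λ w → ¬? (w ≟ p)) (filter (edge? v) (allFin order))

    neighbours-unique : ∀ p v → Unique (neighbours p v)
    neighbours-unique p v = Unique.filter⁺ _ (Unique.filter⁺ (edge? v) (Unique.allFin⁺ order))

    ∈-neighbours : ∀ {p v w} → w ∈ neighbours p v → Edge v w × w ≢ p
    ∈-neighbours {p} {v} w∈ with ∈-filter⁻ (λ w → ¬? (w ≟ p)) w∈
    ... | w∈′ , w≢p = proj₂ (∈-filter⁻ (edge? v) {xs = allFin order} w∈′) , w≢p

    -- The endpoints of the trails in Trail p v of length at most d; for p = v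
    -- this is the tree of depth d rooted at v.
    branch : ℕ → (p v : Vertex) → List Vertex
    branch zero    p v = v ∷ []
    branch (suc d) p v = v ∷ concatMap (branch d v) (neighbours p v)

    ∈-branch : ∀ d {p v y} → y ∈ branch d p v → ∃[ n ] n ≤ d × Trail p v y n
    ∈-branch zero    (here refl) = 0 , z≤n , []
    ∈-branch (suc d) (here refl) = 0 , z≤n , []
    ∈-branch (suc d) {p} {v} (there y∈) with find (∈-concatMap⁻ (branch d v) y∈)
    ... | w , w∈ , y∈w with ∈-neighbours w∈ | ∈-branch d y∈w
    ...   | e , ne | n , n≤d , t = suc n , s≤s n≤d , e ⟨ ne ⟩∷ t

    branch-unique : ∀ d p v → d + d < g → Unique (branch d p v)
    branch-unique zero    p v _   = [] ∷ []
    branch-unique (suc d) p v d<g = All.tabulate root≢ ∷ Unique.concat⁺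
      (All.map⁺ (All.universal (λ w → branch-unique d v w 2d<g) _))
      (AllPairs.map⁺ (allPairs-tabulate (neighbours-unique p v) disjoint))
      where
      2d<g : d + d < g
      2d<g = <-trans (+-mono-< (n<1+n d) (n<1+n d)) d<g

      root≢ : ∀ {y} → y ∈ concatMap (branch d v) (neighbours p v) → v ≢ y
      root≢ y∈ refl with find (∈-concatMap⁻ (branch d v) y∈)
      ... | w , w∈ , y∈w with ∈-neighbours w∈ | ∈-branch d y∈w
      -- The root met again gives a closed trail of length at most `suc d`.
      ...   | e , ne | n , n≤d , t = <⇒≱ d<g (≤-trans (closed-trail {p} z<s (e ⟨ ne ⟩∷ t))
              (≤-trans (s≤s n≤d) (m≤m+n (suc d) (suc d))))

      disjoint : ∀ {u w} → u ∈ neighbours p v → w ∈ neighbours p v → u ≢ w →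
                 Disjoint (branch d v u) (branch d v w)
      disjoint u∈ w∈ u≢w (y∈u , y∈w)
        with ∈-neighbours u∈ | ∈-neighbours w∈ | ∈-branch d y∈u | ∈-branch d y∈w
      ... | eu , _ | ew , _ | n , n≤d , t | m , m≤d , t′ = <⇒≱ d<g (begin
        g                   ≤⟨ closed-trail (≤-trans z<s (m≤n+m _ n)) round ⟩
        n + suc (suc m)     ≡⟨ +-suc n (suc m) ⟩
        suc (n + suc m)     ≤⟨ s≤s (+-mono-≤ n≤d (s≤s m≤d)) ⟩
        suc d + suc d       ∎)
        where
        open ≤-Reasoning
        -- From the common vertex back to `u`, through `v` to `w`, and out again; `u ≢ w` prevents
        -- backtracking at `v`.
        round : Trail _ _ _ (n + suc (suc m))
        round = reverseTrail (edge-sym eu) t (ew ⟨ u≢w ∘ sym ⟩∷ t′)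

    -- Sizes of the trees.

    module Regular (r : ℕ) (edge-regular : ∀ v → degree v ≡ r) where

      length-neighbours : ∀ p v → r ∸ 1 ≤ length (neighbours p v)
      length-neighbours p v = m≤n+o⇒m∸n≤o r 1 (subst (_≤ _) (edge-regular v)
        (length≤1+length-filter-≢ p (Unique.filter⁺ (edge? v) (Unique.allFin⁺ order))))

      length-neighbours-root : ∀ v → length (neighbours v v) ≡ r
      length-neighbours-root v = trans (cong length (filter-all _ (All.map no-loop
        (All.all-filter (edge? v) (allFin order))))) (edge-regular v)
        where
        no-loop : ∀ {w} → Edge v w → w ≢ v
        no-loop e w≡v = edge-irrefl (sym w≡v) e

      length-branch : ∀ d p v → ∑< (suc d) (λ k → (r ∸ 1) ^ k) ≤ length (branch d p v)
      length-branch zero    p v = ≤-refl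
      -- The term for exponent 0 counts the root; a factor `r ∸ 1` taken out of the others counts
      -- the subtrees.
      length-branch (suc d) p v = s≤s (begin
        ∑< (suc d) (λ k → (r ∸ 1) * (r ∸ 1) ^ k)
          ≡⟨ ∑<-*ˡ (r ∸ 1) (suc d) (λ k → (r ∸ 1) ^ k) ⟩
        (r ∸ 1) * ∑< (suc d) (λ k → (r ∸ 1) ^ k)
          ≤⟨ *-monoˡ-≤ _ (length-neighbours p v) ⟩
        length (neighbours p v) * ∑< (suc d) (λ k → (r ∸ 1) ^ k)
          ≤⟨ length-concatMap-≥ (branch d v) (neighbours p v) (length-branch d v) ⟩
        length (concatMap (branch d v) (neighbours p v)) ∎)
        where open ≤-Reasoning

      -- Only the root has `r` subtrees; every vertex below it has lost its predecessor and branches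
      -- into at least `r ∸ 1`.
      length-ball : ∀ d v → ballSize r d ≤ length (branch d v v)
      length-ball zero    v = ≤-refl
      length-ball (suc d) v = s≤s (begin
        ∑< (suc d) (λ k → r * (r ∸ 1) ^ k)
          ≡⟨ ∑<-*ˡ r (suc d) (λ k → (r ∸ 1) ^ k) ⟩
        r * ∑< (suc d) (λ k → (r ∸ 1) ^ k)
          ≡⟨ cong (_* _) (length-neighbours-root v) ⟨
        length (neighbours v v) * ∑< (suc d) (λ k → (r ∸ 1) ^ k)
          ≤⟨ length-concatMap-≥ (branch d v) (neighbours v v) (length-branch d v) ⟩
        length (concatMap (branch d v) (neighbours v v)) ∎)
        where open ≤-Reasoning

    -- Trees along a walk of arcs.

    module ArcPath (x : ℕ → Vertex) (x-arc : ∀ i → Arc (x i) (x (suc i))) where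

      followArcs : ∀ k i {z m} → WalkOfLength (x (k + i)) z m →
                   WalkOfLength (x i) z (k + m)
      followArcs zero    i w = w
      followArcs (suc k) i {z} {m} (w , eq) =
        subst (WalkOfLength (x i) z) (+-suc k m)
          (followArcs k i (along-arc (x-arc (k + i)) ∷ w , cong suc eq))

      trees : ℕ → List Vertex
      trees i = branch (depth g i) (x i) (x i)

      trees-disjoint : ∀ {i j} → i < j → j < g → Disjoint (trees i) (trees j)
      trees-disjoint {i} {j} i<j j<g {y} (y∈i , y∈j) with ∈-branch _ y∈i | ∈-branch _ y∈j
      ... | a , a≤ , s | b , b≤ , t = <-irrefl refl (begin-strict
        g                                ≤⟨ closed-walk-through-arc (x-arc i) (proj₁ back) ⟩
        suc (walkLength (proj₁ back))    ≡⟨ cong suc (proj₂ back) ⟩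
        -- Of the two bounds in `depth`, the earlier tree uses `a ≤ i` here and the later one
        -- `b ≤ g ∸ suc j` below.
        suc (k + (b + (a + 0)))          ≤⟨ s≤s (+-monoʳ-≤ k (+-monoʳ-≤ b (+-monoˡ-≤ 0 (≤-trans a≤ (m⊓n≤m i _))))) ⟩
        suc (k + (b + (i + 0)))          ≡⟨ rearrange k b i ⟩
        b + (k + suc i)                  ≡⟨ cong (b +_) k+1+i≡j ⟩
        b + j                            <⟨ n<1+n (b + j) ⟩
        suc (b + j)                      ≡⟨ +-suc b j ⟨
        b + suc j                        ≤⟨ +-monoˡ-≤ (suc j) (≤-trans b≤ (m⊓n≤n j _)) ⟩
        g ∸ suc j + suc j                ≡⟨ m∸n+n≡m j<g ⟩
        g                                ∎)
        where
        open ≤-Reasoning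
        k : ℕ
        -- The arcs from `x (suc i)` to `x j`; the arc out of `x i` is the one that closes the walk.
        k = j ∸ suc i
        k+1+i≡j : k + suc i ≡ j
        k+1+i≡j = m∸n+n≡m i<j
        rearrange : ∀ k b i → suc (k + (b + (i + 0))) ≡ b + (k + suc i)
        rearrange = solve-∀
        back : WalkOfLength (x (suc i)) (x i) (k + (b + (a + 0)))
        back = followArcs k (suc i) (subst
          (λ l → WalkOfLength (x l) (x i) (b + (a + 0))) (sym k+1+i≡j)
          (prepend t (reverseOnto s ([] , refl))))

      trees-unique : Unique (concat (applyUpTo trees g))
      trees-unique = Unique.concat⁺
        (All.applyUpTo⁺₁ trees g (λ {i} i<g → branch-unique _ _ _ (2depth<g i<g)))
        (AllPairs.applyUpTo⁺₁ trees g trees-disjoint)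
        where
        2depth<g : ∀ {i} → i < g → depth g i + depth g i < g
        2depth<g {i} i<g = begin-strict
          -- Each copy of the minimum is bounded by a different argument, and the two arguments add
          -- up to g - 1.
          depth g i + depth g i    ≤⟨ +-mono-≤ (m⊓n≤n i _) (m⊓n≤m i _) ⟩
          g ∸ suc i + i            <⟨ +-monoʳ-< (g ∸ suc i) (n<1+n i) ⟩
          g ∸ suc i + suc i        ≡⟨ m∸n+n≡m i<g ⟩
          g                        ∎
          where open ≤-Reasoning

-- The bound on the order.

module _ {z r g} {G : MixedGraph} (mixed : IsMixed (suc z) r g G) where
  open MixedGraph G
  open IsMixed mixed

  out-neighbour : ∀ v → ∃[ u ] Arc v u
  out-neighbour v with filter (arc? v) (allFin order) in eq | out-regular v
  -- An empty list is excluded by `out-regular`, as its length would be `suc z`.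
  ... | u ∷ _ | _ = u , proj₂ (∈-filter⁻ (arc? v) {xs = allFin order}
                          (subst (u ∈_) (sym eq) (here refl)))

  arcPath : ℕ → Vertex
  -- A starting vertex comes from the cycle that attains the girth. The infinite walk must repeat
  -- vertices, but only its first `g` terms root trees.
  arcPath zero    = proj₁ (proj₁ girth)
  arcPath (suc i) = proj₁ (out-neighbour (arcPath i))

  order-bound : 3 ≤ g → lowerBound r g ≤ order
  order-bound 3≤g = begin
    lowerBound r g                      ≡⟨ lowerBound-∑ r g 3≤g ⟩
    ∑< g (ballSize r ∘ depth g)         ≤⟨ ∑<-≤-length-concat trees g (λ i → length-ball (depth g i) (arcPath i)) ⟩
    length (concat (applyUpTo trees g)) ≤⟨ unique⇒length≤ trees-unique ⟩
    order                               ∎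
    where
    open ≤-Reasoning
    open Walks G
    open LongCycles g (proj₂ girth)
    open Regular r edge-regular
    open ArcPath arcPath (λ i → proj₂ (out-neighbour (arcPath i)))

theorem2 : (r g : ℕ) → r ≥ 1 → g ≥ 3 →
           (n : ℕ) → CageOrder 1 r g n → n ≥ lowerBound r g
theorem2 r g _ g≥3 _ (_ , cage , refl) = order-bound (IsMixedCage.isMixed cage) g≥3
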